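{- Let $n \geq 1$ be an integer, let $T_i=\binom{i+1}{2}$, and let $(\rho_n,\lambda_n)$ be the unique pair of integers with $\rho_n \geq 1$, $0 \leq \lambda_n \leq \rho_n+1$ and $n = T_{\rho_n+1}-2+\lambda_n$. For every maximum weight jump-float sequence $s \in \mathcal{M}^*_n$, its extended block sequence $\overline{b}$ has one of the following forms: A. $\overline{b} = (\overline{b}_1, \overline{b}_2, \ldots, \overline{b}_{\rho_n})$ where $$\overline{b}_j = \begin{cases} j & \text{for } j \notin X,\\ j+1 & \text{for } j \in X,\end{cases} \qquad\text{for some } X \in \binom{[\rho_n]}{\lambda_n};$$ B. $\overline{b} = (\overline{b}_1, \overline{b}_2, \ldots, \overline{b}_{\rho_n+1})$ where $$\overline{b}_j = \begin{cases} j & \text{for } j \in X,\\ j-1 & \text{for } j \notin X,\end{cases} \qquad\text{for some } X \in \binom{[\rho_n+1]}{\lambda_n-1}.$$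
   Context: A jump-float sequence of length $n$ is an integer sequence $s=(s_1,\ldots,s_n)$ with $0\le s_i\le i$ for $1\le i\le n$ and such that, for $2\le i\le n$, if $s_i>s_{i-1}$ then $s_{i-1}=0$. Its weight is $w(s)=\sum_{i=1}^n s_i$. $\mathcal{M}^*_n$ is the set of jump-float sequences of length $n$ of maximum weight among all jump-float sequences of length $n$ (each of these is also maximal in the componentwise order). A block of $s\in\mathcal{M}^*_n$ is a maximal run of consecutive nonzero entries of $s$; its width is the length of the run. The block sequence $b=(b_1,\ldots,b_k)$ of $s$ is the list of widths of the blocks of $s$, from left to right. The extended block sequence $\overline{b}$ of $s$ is $\overline{b}=b$ if $s_1=1$, and $\overline{b}=(0,b_1,b_2,\ldots,b_k)$ if $s_1=0$. $\binom{[m]}{r}$ denotes the set of $r$-element subsets of $[m]=\{1,\ldots,m\}$, which is empty if $r<0$ or $r>m$. -}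

module Defs where

open import Data.Bool using (if_then_else_)
open import Data.Fin using (Fin; toℕ)
open import Data.Fin.Subset using (Subset; ∣_∣)
open import Data.Fin.Subset.Properties using (_∈?_)
open import Data.List using (List; []; _∷_; length; map; tabulate; wordsBy)
open import Data.Nat
open import Data.Nat.Combinatorics using (_C_; nC1≡n; nCk+nC[k+1]≡[n+1]C[k+1])
open import Data.Nat.Properties
open import Data.Product using (_×_; _,_; ∃-syntax; ∃!)
open import Data.Vec using (Vec; []; _∷_; lookup; sum; toList)
open import Data.Empty using (⊥; ⊥-elim)
open import Relation.Binary.Definitions using (tri<; tri≈; tri>)
open import Relation.Binary.PropositionalEquality using (_≡_; refl; sym; trans; cong; cong₂; subst)
open import Relation.Nullary using (does; yes; no)

-- Indices are shifted: position i : Fin n carries the entry s_(toℕ i + 1).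
-- The lower bound 0 ≤ s_i is built into the entry type ℕ.
record IsJumpFloat {n : ℕ} (s : Vec ℕ n) : Set where
  field
    bounded : ∀ i → lookup s i ≤ suc (toℕ i)
    jump    : ∀ i j → toℕ j ≡ suc (toℕ i) →
              lookup s j > lookup s i → lookup s i ≡ 0

weight : ∀ {n} → Vec ℕ n → ℕ
weight = sum

record IsMaxWeight {n : ℕ} (s : Vec ℕ n) : Set where
  field
    jumpFloat : IsJumpFloat s
    maximum   : ∀ (t : Vec ℕ n) → IsJumpFloat t → weight t ≤ weight s

-- wordsBy cuts the sequence at its zero entries and discards empty pieces, so
-- what remains are the maximal runs of nonzero entries, from left to right.
blockSequence : ∀ {n} → Vec ℕ n → List ℕ
blockSequence s = map length (wordsBy (_≟ 0) (toList s))

-- In a jump-float sequence the first entry is 0 or 1, so the last clause is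
-- the case s₁ = 1.
extendedBlockSequence : ∀ {n} → Vec ℕ n → List ℕ
extendedBlockSequence []              = []
extendedBlockSequence s@(zero ∷ _)    = 0 ∷ blockSequence s
extendedBlockSequence s@(suc _ ∷ _)   = blockSequence s

T : ℕ → ℕ
T i = (i + 1) C 2

-- The truncated subtraction is exact: T (ρ + 1) ≥ 3 whenever ρ ≥ 1.
record IsRhoLambda (n ρ ℓ : ℕ) : Set where
  constructor mkRhoLambda
  field
    ρ≥1   : ρ ≥ 1
    ℓ≤ρ+1 : ℓ ≤ ρ + 1
    n≡    : n ≡ T (ρ + 1) ∸ 2 + ℓ

-- X : Subset m is a subset of [m], with i : Fin m standing for j = toℕ i + 1.
entryA entryB : ∀ {m} → Subset m → Fin m → ℕ
entryA X i = let j = suc (toℕ i) in if does (i ∈? X) then j + 1 else j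
entryB X i = let j = suc (toℕ i) in if does (i ∈? X) then j else j ∸ 1

FormA : ℕ → ℕ → List ℕ → Set
FormA ρ ℓ b = ∃[ X ] ∣ X ∣ ≡ ℓ × b ≡ tabulate {n = ρ} (entryA X)

-- ∣ X ∣ + 1 ≡ ℓ rather than ∣ X ∣ ≡ ℓ ∸ 1: there is no set of size ℓ - 1
-- when ℓ = 0.
FormB : ℕ → ℕ → List ℕ → Set
FormB ρ ℓ b = ∃[ X ] ∣ X ∣ + 1 ≡ ℓ × b ≡ tabulate {n = ρ + 1} (entryB X)

private
  T-suc : ∀ i → T (suc i) ≡ T i + (i + 1)
  T-suc i = trans (sym (nCk+nC[k+1]≡[n+1]C[k+1] (i + 1) 1))
           (trans (cong (_+ T i) (nC1≡n (i + 1))) (+-comm (i + 1) (T i)))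

  -- the least n whose ρ is r + 1
  base : ℕ → ℕ
  base r = T (suc r + 1) ∸ 2

  2≤T : ∀ r → 2 ≤ T (suc r + 1)
  2≤T zero    = s≤s (s≤s z≤n)
  2≤T (suc r) = ≤-trans (2≤T r)
    (subst (T (suc r + 1) ≤_) (sym (T-suc (suc r + 1))) (m≤m+n _ _))

  base-suc : ∀ r → base (suc r) ≡ base r + suc (suc r + 1)
  base-suc r = trans (cong (_∸ 2) (T-suc (suc r + 1)))
    (trans (+-∸-comm (suc r + 1 + 1) (2≤T r))
           (cong (base r +_) (+-comm (suc r + 1) 1)))

  base-mono : ∀ {r r′} → r ≤′ r′ → base r ≤ base r′
  base-mono ≤′-refl = ≤-refl
  base-mono (≤′-step {n = r′} p) = ≤-trans (base-mono p)
    (subst (base r′ ≤_) (sym (base-suc r′)) (m≤m+n _ _))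

  exists : ∀ n → ∃[ r ] ∃[ ℓ ] IsRhoLambda (suc n) (suc r) ℓ
  exists zero = 0 , 0 , mkRhoLambda (s≤s z≤n) z≤n refl
  exists (suc n) with exists n
  ... | r , ℓ , mkRhoLambda _ ℓ≤ n≡ with ℓ ≟ suc r + 1
  ...   | no ℓ≢ = r , suc ℓ , mkRhoLambda (s≤s z≤n) (≤∧≢⇒< ℓ≤ ℓ≢)
            (trans (cong suc n≡) (sym (+-suc (base r) ℓ)))
  ...   | yes refl = suc r , 0 , mkRhoLambda (s≤s z≤n) z≤n
            (trans (cong suc n≡) (trans (sym (+-suc (base r) (suc r + 1)))
            (trans (sym (base-suc r)) (sym (+-identityʳ _)))))

  not-below : ∀ {n r r′ ℓ ℓ′} → IsRhoLambda n (suc r) ℓ →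
              IsRhoLambda n (suc r′) ℓ′ → r < r′ → ⊥
  not-below {n} {r} {r′} {ℓ} {ℓ′} (mkRhoLambda _ ℓ≤ n≡) (mkRhoLambda _ _ n≡′) r<r′ =
    <-irrefl refl (begin-strict
      n                         ≡⟨ n≡ ⟩
      base r + ℓ                <⟨ +-monoʳ-< (base r) (s≤s ℓ≤) ⟩
      base r + suc (suc r + 1)  ≡⟨ sym (base-suc r) ⟩
      base (suc r)              ≤⟨ base-mono (≤⇒≤′ r<r′) ⟩
      base r′                   ≤⟨ m≤m+n (base r′) ℓ′ ⟩
      base r′ + ℓ′              ≡⟨ sym n≡′ ⟩
      n                         ∎)
    where open ≤-Reasoning

  unique : ∀ {n ρ ℓ ρ′ ℓ′} → IsRhoLambda n ρ ℓ → IsRhoLambda n ρ′ ℓ′ →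
           (ρ , ℓ) ≡ (ρ′ , ℓ′)
  unique {ρ = zero} (mkRhoLambda () _ _) _
  unique {ρ = suc _} {ρ′ = zero} _ (mkRhoLambda () _ _)
  unique {ρ = suc r} {ρ′ = suc r′} p q with <-cmp r r′
  ... | tri< r<r′ _ _ = ⊥-elim (not-below p q r<r′)
  ... | tri> _ _ r′<r = ⊥-elim (not-below q p r′<r)
  ... | tri≈ _ refl _ = cong (suc r ,_)
    (+-cancelˡ-≡ (base r) _ _ (trans (sym (IsRhoLambda.n≡ p)) (IsRhoLambda.n≡ q)))

∃!RhoLambda : ∀ n → n ≥ 1 → ∃! _≡_ (λ ((ρ , ℓ) : ℕ × ℕ) → IsRhoLambda n ρ ℓ)
∃!RhoLambda (suc n) _ with exists n
... | r , ℓ , p = (suc r , ℓ) , p , λ q → unique p q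

{-# OPTIONS --safe #-}
module Submission where

open import Defs
open import Data.Bool using (if_then_else_)
open import Data.Fin using (zero; suc; toℕ)
open import Data.Fin.Subset using (Subset; inside; outside; ∣_∣; ⊤)
open import Data.Fin.Subset.Properties using (_∈?_; ∣⊤∣≡n)
open import Data.List using (List; []; _∷_; _∷ʳ_; _++_; length; map; drop; tabulate)
open import Data.List.Properties using (++-identityʳ; ∷ʳ-++; length-reverse; tabulate-cong)
open import Data.List.Relation.Unary.All using (All; []; _∷_)
open import Data.Nat
open import Data.Nat.Combinatorics using (_C_; nC1≡n; nCk+nC[k+1]≡[n+1]C[k+1])
open import Data.Nat.Properties
open import Data.Nat.Tactic.RingSolver using (solve-∀)
open import Data.Product using (_×_; _,_; proj₁; proj₂; ∃-syntax)
open import Data.Sum using (_⊎_; inj₁; inj₂)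
open import Data.Unit using (tt) renaming (⊤ to Unit)
open import Data.Vec as Vec using (Vec; []; _∷_; toList)
open import Data.Vec.Properties using (sum-++)
open import Relation.Binary.Definitions using (tri<; tri≈; tri>)
open import Relation.Binary.PropositionalEquality
open import Relation.Nullary using (does; contradiction)

-- A jump-float sequence with given block widths c₁, …, c_k (zero widths allowed)
-- weighs at most Σ c_j p_j, where p_j is the first position of block j, with
-- equality when every block is constant.  Let N be the length plus one, so that
-- a block of width c adds c + 1 to N, and let F(N) be the maximum weight.  With
-- N in coordinates (ρ, λ), F is given by F(N+1) − F(N) = N − ρ.  A further block
-- loses F(N+c+1) − F(N) − c(N+1), and increasing c by one changes this loss by
-- c − ρ(N+c+1).  Since ρ grows slowly, the loss is nonnegative and vanishes only
-- for c = ρ+1, for c = ρ+2 and, if λ = 0, for c = ρ.  By induction on the number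
-- of blocks, appending these widths yields precisely the staircases A and B.

-- The coordinates (λ, ρ + 1 - λ).

next : ℕ × ℕ → ℕ × ℕ
next (λ′ , suc μ) = suc λ′ , μ
next (λ′ , zero)  = 0 , suc λ′

-- The pair (λ_n , ρ_n + 1 - λ_n) for n = N - 1, started at n = -1.
coords : ℕ → ℕ × ℕ
coords zero    = 0 , 1
coords (suc N) = next (coords N)

-- ρ_n + 1 for n = N - 1.
κ : ℕ → ℕ
κ N = proj₁ (coords N) + proj₂ (coords N)

-- In length N - 1; the subtraction is exact by κ≤.
maxWeight : ℕ → ℕ
maxWeight zero    = 0
maxWeight (suc N) = maxWeight N + (suc N ∸ κ N)

κ-next : ∀ N → κ N ≤ κ (suc N) × κ (suc N) ≤ suc (κ N)
κ-next N with coords N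
... | l , suc m = ≤-reflexive (+-suc l m) , ≤-trans (≤-reflexive (sym (+-suc l m))) (n≤1+n _)
... | l , zero rewrite +-identityʳ l = n≤1+n l , ≤-refl

κ-mono : ∀ N d → κ N ≤ κ (d + N)
κ-mono N zero    = ≤-refl
κ-mono N (suc d) = ≤-trans (κ-mono N d) (proj₁ (κ-next (d + N)))

κ≤ : ∀ N → κ N ≤ suc N
κ≤ zero    = ≤-refl
κ≤ (suc N) = ≤-trans (proj₂ (κ-next N)) (s≤s (κ≤ N))

maxWeight-suc : ∀ N → maxWeight (suc N) + κ N ≡ maxWeight N + suc N
maxWeight-suc N = trans (+-assoc (maxWeight N) _ _) (cong (maxWeight N +_) (m∸n+n≡m (κ≤ N)))

-- From `(l , m)`, `m` steps lead to `(l + m , 0)`, one more to `(0 , suc (l + m))` and `l` more to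
-- `(l , suc m)`. The induction moves both ends; when `κ` grows at `N`, the far end moves two steps.
coords-shift : ∀ N → coords (κ N + suc N) ≡ (proj₁ (coords N) , suc (proj₂ (coords N)))
coords-shift zero = refl
coords-shift (suc N) with coords N | coords-shift N
... | l , suc m | eq = begin
    coords (suc (l + m) + suc (suc N))
      ≡⟨ cong coords {suc (l + m) + suc (suc N)} {suc (l + suc m + suc N)} (arith l m N) ⟩
    next (coords (l + suc m + suc N))
      ≡⟨ cong next eq ⟩
    (suc l , suc m) ∎
  where
  open ≡-Reasoning
  arith : ∀ l m N → suc (l + m) + suc (suc N) ≡ suc (l + suc m + suc N)
  arith = solve-∀
... | l , zero | eq = begin
    coords (suc l + suc (suc N))
      ≡⟨ cong coords {suc l + suc (suc N)} {suc (suc (l + zero + suc N))} (arith l N) ⟩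
    next (next (coords (l + zero + suc N)))
      ≡⟨ cong (λ p → next (next p)) eq ⟩
    (0 , suc (suc l)) ∎
  where
  open ≡-Reasoning
  arith : ∀ l N → suc l + suc (suc N) ≡ suc (suc (l + zero + suc N))
  arith = solve-∀

κ-shift : ∀ N → κ (κ N + suc N) ≡ suc (κ N)
κ-shift N rewrite coords-shift N = +-suc _ _

coords-advance : ∀ N d {l m} → coords N ≡ (l , d + m) → coords (d + N) ≡ (d + l , m)
coords-advance N zero    eq = eq
coords-advance N (suc d) {l} {m} eq = cong next
  (coords-advance N d (trans eq (cong (l ,_) (sym (+-suc d m)))))

κ-of : ∀ N {l m} → coords N ≡ (l , m) → κ N ≡ l + m
κ-of N eq = cong (λ p → proj₁ p + proj₂ p) eq

-- The last equation gives `κ` between the two steps of the far end, where `maxWeight` needs it.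
κ-cases : ∀ N → κ (suc N) ≡ κ N ⊎
                (κ (suc N) ≡ suc (κ N) × κ (suc (κ N + suc N)) ≡ suc (κ N))
κ-cases N with coords N in eq | coords-shift N
... | l , suc m | _   = inj₁ (sym (+-suc l m))
... | l , zero  | sh  = inj₂ (cong suc (sym (+-identityʳ l)) ,
        κ-of (suc (l + zero + suc N)) (cong next sh))

-- The weight lost by a further block.

maxWeight-suc-shift : ∀ N → maxWeight (κ N + suc N) ≡ maxWeight N + κ N * suc N →
  maxWeight (suc (κ N + suc N)) + suc (κ N) ≡ maxWeight N + κ N * suc N + suc (κ N + suc N)
maxWeight-suc-shift N eq =
  trans (cong (maxWeight (suc (κ N + suc N)) +_) (sym (κ-shift N)))
  (trans (maxWeight-suc (κ N + suc N)) (cong (_+ suc (κ N + suc N)) eq))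

-- Induction on `N`, comparing the growth of both sides: the far end `M` moves by one, or by two if
-- `κ` grows at `N`. Values of `κ` are added to both sides and cancelled, which avoids truncated
-- subtraction.
maxWeight-shift : ∀ N → maxWeight (κ N + suc N) ≡ maxWeight N + κ N * suc N
maxWeight-shift zero = refl
maxWeight-shift (suc N) = case (κ-cases N)
  where
  open ≡-Reasoning
  k M : ℕ
  k = κ N
  M = k + suc N
  P : ℕ → Set
  P z = maxWeight (z + suc (suc N)) ≡ maxWeight (suc N) + z * suc (suc N)
  top : maxWeight (suc M) + suc k ≡ maxWeight N + k * suc N + suc M
  top = maxWeight-suc-shift N (maxWeight-shift N)
  arith₁ : ∀ f k N → f + k * suc N + suc (k + suc N) + k ≡ f + suc N + (k * suc (suc N) + suc k)
  arith₁ = solve-∀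
  arith₂ : ∀ f k g → f + k + (g + suc k) ≡ f + g + (suc k + k)
  arith₂ = solve-∀
  arith₃ : ∀ f g k → f + g + (suc k + k) ≡ f + suc k + (g + k)
  arith₃ = solve-∀
  arith₄ : ∀ f k N → f + k * suc N + suc (k + suc N) + (suc (suc (k + suc N)) + k) ≡
           f + suc N + (suc k * suc (suc N) + (suc k + suc k))
  arith₄ = solve-∀
  arith₅ : ∀ f g k → f + k + (g + (suc k + suc k)) ≡ f + g + (suc k + (suc k + k))
  arith₅ = solve-∀
  same : P k
  same = +-cancelʳ-≡ (suc k + k) _ _ (begin
    maxWeight (k + suc (suc N)) + (suc k + k)
      ≡⟨ cong (λ z → maxWeight z + (suc k + k)) (+-suc k (suc N)) ⟩
    maxWeight (suc M) + (suc k + k)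
      ≡⟨ sym (+-assoc (maxWeight (suc M)) _ _) ⟩
    maxWeight (suc M) + suc k + k
      ≡⟨ cong (_+ k) top ⟩
    maxWeight N + k * suc N + suc M + k
      ≡⟨ arith₁ (maxWeight N) k N ⟩
    maxWeight N + suc N + (k * suc (suc N) + suc k)
      ≡⟨ cong (_+ (k * suc (suc N) + suc k)) (sym (maxWeight-suc N)) ⟩
    maxWeight (suc N) + k + (k * suc (suc N) + suc k)
      ≡⟨ arith₂ (maxWeight (suc N)) k _ ⟩
    maxWeight (suc N) + k * suc (suc N) + (suc k + k) ∎)
  wrap : κ (suc M) ≡ suc k → P (suc k)
  wrap κ≡ = +-cancelʳ-≡ (suc k + (suc k + k)) _ _ (begin
    maxWeight (suc k + suc (suc N)) + (suc k + (suc k + k))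
      ≡⟨ cong (λ z → maxWeight (suc z) + (suc k + (suc k + k))) (+-suc k (suc N)) ⟩
    maxWeight (suc (suc M)) + (suc k + (suc k + k))
      ≡⟨ sym (+-assoc (maxWeight (suc (suc M))) _ _) ⟩
    maxWeight (suc (suc M)) + suc k + (suc k + k)
      ≡⟨ cong (λ z → maxWeight (suc (suc M)) + z + (suc k + k)) (sym κ≡) ⟩
    maxWeight (suc (suc M)) + κ (suc M) + (suc k + k)
      ≡⟨ cong (_+ (suc k + k)) (maxWeight-suc (suc M)) ⟩
    maxWeight (suc M) + suc (suc M) + (suc k + k)
      ≡⟨ arith₃ (maxWeight (suc M)) (suc (suc M)) k ⟩
    maxWeight (suc M) + suc k + (suc (suc M) + k)
      ≡⟨ cong (_+ (suc (suc M) + k)) top ⟩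
    maxWeight N + k * suc N + suc M + (suc (suc M) + k)
      ≡⟨ arith₄ (maxWeight N) k N ⟩
    maxWeight N + suc N + (suc k * suc (suc N) + (suc k + suc k))
      ≡⟨ cong (_+ (suc k * suc (suc N) + (suc k + suc k))) (sym (maxWeight-suc N)) ⟩
    maxWeight (suc N) + k + (suc k * suc (suc N) + (suc k + suc k))
      ≡⟨ arith₅ (maxWeight (suc N)) (suc k * suc (suc N)) k ⟩
    maxWeight (suc N) + suc k * suc (suc N) + (suc k + (suc k + k)) ∎)
  case : κ (suc N) ≡ κ N ⊎ (κ (suc N) ≡ suc (κ N) × κ (suc M) ≡ suc k) → P (κ (suc N))
  case (inj₁ eq)        = subst P (sym eq) same
  case (inj₂ (eq , eq′)) = subst P (sym eq) (wrap eq′)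

-- The best weight of N - 1 entries, a separating zero and then c entries.
withBlock : ℕ → ℕ → ℕ
withBlock N c = maxWeight N + c * suc N

κ-above : ∀ N d → κ (suc d + κ N + suc N) ≤ suc d + κ N
κ-above N zero    = ≤-reflexive (κ-of (suc (κ N + suc N)) (cong next (coords-shift N)))
κ-above N (suc d) = ≤-trans (proj₂ (κ-next (suc d + κ N + suc N))) (s≤s (κ-above N d))

maxWeight-wide : ∀ N → maxWeight (suc (κ N) + suc N) ≡ withBlock N (suc (κ N))
maxWeight-wide N = +-cancelʳ-≡ (suc (κ N)) _ _
    (trans (maxWeight-suc-shift N (maxWeight-shift N)) (sym (arith (maxWeight N) (κ N) N)))
  where
  arith : ∀ f k N → f + suc k * suc N + suc k ≡ f + k * suc N + suc (k + suc N)
  arith = solve-∀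

-- Widening a block from `c` to `suc c` changes the loss by `suc c - κ M`. Width `suc (κ N)` loses
-- nothing, and from there on `κ M ≤ c`, so each further entry costs at least 1.
withBlock-above : ∀ N d → withBlock N (suc d + κ N) + d ≤ maxWeight (suc d + κ N + suc N)
withBlock-above N zero = ≤-reflexive (trans (+-identityʳ _) (sym (maxWeight-wide N)))
withBlock-above N (suc d) = +-cancelʳ-≤ (κ M) _ _ (begin
    withBlock N (suc c) + suc d + κ M   ≤⟨ +-monoʳ-≤ (withBlock N (suc c) + suc d) (κ-above N d) ⟩
    withBlock N (suc c) + suc d + c     ≡⟨ arith (maxWeight N) c d N ⟩
    withBlock N c + d + suc M           ≤⟨ +-monoˡ-≤ (suc M) (withBlock-above N d) ⟩
    maxWeight M + suc M                 ≡⟨ sym (maxWeight-suc M) ⟩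
    maxWeight (suc M) + κ M             ∎)
  where
  open ≤-Reasoning
  c M : ℕ
  c = suc d + κ N
  M = c + suc N
  arith : ∀ f c d N → f + suc c * suc N + suc d + c ≡ f + c * suc N + d + suc (c + suc N)
  arith = solve-∀

-- The same change of loss, read downwards.
withBlock-shorten : ∀ N c x y → withBlock N (suc c) + x ≤ maxWeight (suc c + suc N) →
  suc c + y ≤ κ (c + suc N) → withBlock N c + (x + y) ≤ maxWeight (c + suc N)
withBlock-shorten N c x y p q = +-cancelʳ-≤ (suc M) _ _ (begin
    withBlock N c + (x + y) + suc M           ≡⟨ arith (maxWeight N) c x y N ⟩
    withBlock N (suc c) + x + (suc c + y)     ≤⟨ +-mono-≤ p q ⟩
    maxWeight (suc M) + κ M                   ≡⟨ maxWeight-suc M ⟩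
    maxWeight M + suc M                       ∎)
  where
  open ≤-Reasoning
  M : ℕ
  M = c + suc N
  arith : ∀ f c x y N → f + c * suc N + (x + y) + suc (c + suc N) ≡ f + suc c * suc N + x + (suc c + y)
  arith = solve-∀

κ-mono-suc : ∀ N c → κ N ≤ κ (c + suc N)
κ-mono-suc N c = ≤-trans (proj₁ (κ-next N)) (κ-mono (suc N) c)

-- Here `κ` is only known not to drop after `N`, so the first entry removed from width `κ N` may be
-- free; every later removal costs at least 1. Hence `pred e`.
withBlock-below : ∀ N c e → c + e ≡ κ N → withBlock N c + pred e ≤ maxWeight (c + suc N)
withBlock-below N c zero eq rewrite +-identityʳ c | eq =
  ≤-reflexive (trans (+-identityʳ _) (sym (maxWeight-shift N)))
withBlock-below N c (suc e) eq = ≤-trans (+-monoʳ-≤ (withBlock N c) (m≤n+m e (pred e)))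
  (withBlock-shorten N c (pred e) e (withBlock-below N (suc c) e eq′)
    (≤-trans (≤-reflexive eq′) (κ-mono-suc N c)))
  where
  eq′ : suc c + e ≡ κ N
  eq′ = trans (sym (+-suc c e)) eq

-- With λ positive the wrap comes early, `suc m` steps after `N`, and `c + suc N` lies `l` steps
-- beyond it. There `κ` exceeds `κ N`, so the first removal is not free.
withBlock-one-short : ∀ N c {l m} → coords N ≡ (suc l , m) → suc c ≡ κ N →
  withBlock N c < maxWeight (c + suc N)
withBlock-one-short N c {l} {m} coords≡ c≡ =
  subst (_≤ maxWeight (c + suc N)) (+-comm _ 1) (withBlock-shorten N c 0 1
    (withBlock-below N (suc c) 0 (trans (+-identityʳ _) c≡)) long)
  where
  open ≤-Reasoning
  κ≡ : κ N ≡ suc l + m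
  κ≡ = κ-of N coords≡
  c≡l+m : c ≡ l + m
  c≡l+m = suc-injective (trans c≡ κ≡)
  at : coords (suc (m + N)) ≡ (0 , suc (m + suc l))
  at = cong next (coords-advance N m (trans coords≡ (cong (suc l ,_) (sym (+-identityʳ m)))))
  arith : ∀ l m → suc (l + m) + 1 ≡ suc (m + suc l)
  arith = solve-∀
  long : suc c + 1 ≤ κ (c + suc N)
  long = begin
    suc c + 1               ≡⟨ cong (λ z → suc z + 1) c≡l+m ⟩
    suc (l + m) + 1         ≡⟨ arith l m ⟩
    suc (m + suc l)         ≡⟨ sym (κ-of (suc (m + N)) at) ⟩
    κ (suc (m + N))         ≤⟨ κ-mono (suc (m + N)) l ⟩
    κ (l + suc (m + N))     ≡⟨ cong κ (trans (cong (l +_) (sym (+-suc m N))) (sym (+-assoc l m (suc N)))) ⟩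
    κ (l + m + suc N)       ≡⟨ cong (λ z → κ (z + suc N)) (sym c≡l+m) ⟩
    κ (c + suc N)           ∎

withBlock-≤ : ∀ N c → withBlock N c ≤ maxWeight (c + suc N)
withBlock-≤ N c with ≤-<-connex c (κ N)
... | inj₁ c≤κ = m+n≤o⇒m≤o _ (withBlock-below N c (κ N ∸ c) (m+[n∸m]≡n c≤κ))
... | inj₂ κ<c = subst (λ z → withBlock N z ≤ maxWeight (z + suc N))
  (trans (sym (+-suc (c ∸ suc (κ N)) (κ N))) (m∸n+n≡m κ<c))
  (m+n≤o⇒m≤o _ (withBlock-above N (c ∸ suc (κ N))))

data BlockWidth (N : ℕ) : ℕ → Set where
  narrow : BlockWidth N (κ N)
  wide   : BlockWidth N (suc (κ N))
  short  : ∀ {c} → coords N ≡ (0 , suc c) → BlockWidth N c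

blockWidth : ∀ N c → maxWeight (c + suc N) ≤ withBlock N c → BlockWidth N c
blockWidth N c tight with <-cmp c (κ N)
... | tri≈ _ refl _ = narrow
... | tri> _ _ κ<c with m≤n⇒∃[o]m+o≡n κ<c
...   | zero , refl rewrite +-identityʳ (κ N) = wide
...   | suc d , refl = contradiction (≤-trans
          (subst (λ z → withBlock N z + suc d ≤ maxWeight (z + suc N))
            (cong suc (+-comm (suc d) (κ N))) (withBlock-above N (suc d)))
          tight) (m+1+n≰m _)
blockWidth N c tight | tri< c<κ _ _ with m≤n⇒∃[o]m+o≡n c<κ
-- Two or more short of `κ N` always loses; exactly one short depends on λ.
...   | suc e , eq = contradiction (≤-trans
          (withBlock-below N c (suc (suc e)) (trans (+-suc c (suc e)) eq))
          tight) (m+1+n≰m _)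
...   | zero , eq with coords N in coords≡
...     | suc l , m = contradiction tight (<⇒≱ (withBlock-one-short N c coords≡
            (trans (trans (cong suc (sym (+-identityʳ c))) eq) (sym (κ-of N coords≡)))))
...     | zero , m = short (trans coords≡
            (cong (0 ,_) (sym (trans (cong suc (sym (+-identityʳ c))) eq))))

-- Staircases and their extension by a block.

stairs : ∀ {m} → ℕ → Subset m → List ℕ
stairs o []            = []
stairs o (inside  ∷ X) = suc o ∷ stairs (suc o) X
stairs o (outside ∷ X) = o ∷ stairs (suc o) X

stairs-∷ʳ-outside : ∀ {m} o (X : Subset m) →
  stairs o (X Vec.∷ʳ outside) ≡ stairs o X ∷ʳ (o + m)
stairs-∷ʳ-outside o [] = cong (_∷ []) (sym (+-identityʳ o))
stairs-∷ʳ-outside {suc m} o (inside ∷ X) rewrite +-suc o m = cong (suc o ∷_) (stairs-∷ʳ-outside (suc o) X)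
stairs-∷ʳ-outside {suc m} o (outside ∷ X) rewrite +-suc o m = cong (o ∷_) (stairs-∷ʳ-outside (suc o) X)

stairs-∷ʳ-inside : ∀ {m} o (X : Subset m) →
  stairs o (X Vec.∷ʳ inside) ≡ stairs o X ∷ʳ suc (o + m)
stairs-∷ʳ-inside o [] = cong (λ z → suc z ∷ []) (sym (+-identityʳ o))
stairs-∷ʳ-inside {suc m} o (inside ∷ X) rewrite +-suc o m = cong (suc o ∷_) (stairs-∷ʳ-inside (suc o) X)
stairs-∷ʳ-inside {suc m} o (outside ∷ X) rewrite +-suc o m = cong (o ∷_) (stairs-∷ʳ-inside (suc o) X)

∣∷ʳoutside∣ : ∀ {m} (X : Subset m) → ∣ X Vec.∷ʳ outside ∣ ≡ ∣ X ∣
∣∷ʳoutside∣ []            = refl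
∣∷ʳoutside∣ (inside  ∷ X) = cong suc (∣∷ʳoutside∣ X)
∣∷ʳoutside∣ (outside ∷ X) = ∣∷ʳoutside∣ X

∣∷ʳinside∣ : ∀ {m} (X : Subset m) → ∣ X Vec.∷ʳ inside ∣ ≡ suc ∣ X ∣
∣∷ʳinside∣ []            = refl
∣∷ʳinside∣ (inside  ∷ X) = cong suc (∣∷ʳinside∣ X)
∣∷ʳinside∣ (outside ∷ X) = ∣∷ʳinside∣ X

-- The overlap that lets a staircase pass from form A to form B.
stairs-empty : ∀ {m} o (X : Subset m) → ∣ X ∣ ≡ 0 → stairs (suc o) X ≡ stairs o (⊤ {n = m})
stairs-empty o []            _  = refl
stairs-empty o (outside ∷ X) eq = cong (suc o ∷_) (stairs-empty (suc o) X eq)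

-- Form A is the case o = 1 and form B the case o = 0.
-- The set X is the paper's, and λμ is as in coords.
record IsStaircase (λμ : ℕ × ℕ) (b : List ℕ) : Set where
  constructor staircase
  field
    {m}  : ℕ
    o    : ℕ
    X    : Subset m
    o≤1  : o ≤ 1
    o+m≡ : o + m ≡ proj₁ λμ + proj₂ λμ
    ∣X∣≡ : suc ∣ X ∣ ≡ o + proj₁ λμ
    b≡   : b ≡ stairs o X

-- `narrow` adds a last index outside `X`, `wide` one inside. `short` has λ = 0, which forces `o` to
-- be 1 and `X` empty; the widths 1, ..., `c` are then reread with offset 0 and full `X`, and the
-- new `c` is a last index outside.
isStaircase-∷ʳ : ∀ {N b c} → IsStaircase (coords N) b → BlockWidth N c →
  IsStaircase (coords (c + suc N)) (b ∷ʳ c)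
isStaircase-∷ʳ {N} (staircase {m} o X o≤1 o+m≡ ∣X∣≡ refl) narrow rewrite coords-shift N =
  staircase o (X Vec.∷ʳ outside) o≤1
    (trans (+-suc o m) (trans (cong suc o+m≡) (sym (+-suc (proj₁ (coords N)) _))))
    (trans (cong suc (∣∷ʳoutside∣ X)) ∣X∣≡)
    (trans (cong (stairs o X ∷ʳ_) (sym o+m≡)) (sym (stairs-∷ʳ-outside o X)))
isStaircase-∷ʳ {N} (staircase {m} o X o≤1 o+m≡ ∣X∣≡ refl) wide rewrite coords-shift N =
  staircase o (X Vec.∷ʳ inside) o≤1
    (trans (+-suc o m) (cong suc o+m≡))
    (trans (cong suc (trans (∣∷ʳinside∣ X) ∣X∣≡)) (sym (+-suc o _)))
    (trans (cong (λ z → stairs o X ∷ʳ suc z) (sym o+m≡)) (sym (stairs-∷ʳ-inside o X)))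
isStaircase-∷ʳ {N} {c = c} (staircase o X o≤1 o+m≡ ∣X∣≡ b≡) (short coords≡)
  with coords N | coords≡
     | coords-advance N (suc c) (trans coords≡ (cong (0 ,_) (sym (+-identityʳ (suc c)))))
isStaircase-∷ʳ (staircase zero _ _ _ () _) (short _) | _ | refl | _
isStaircase-∷ʳ {N} {c = c} (staircase (suc zero) X _ refl ∣X∣≡ refl) (short _) | _ | refl | eq
  rewrite +-suc c N | +-identityʳ c | eq =
  staircase 0 (⊤ {n = c} Vec.∷ʳ outside) z≤n (cong suc (sym (+-identityʳ c)))
    (cong suc (trans (∣∷ʳoutside∣ (⊤ {n = c})) (∣⊤∣≡n c)))
    (trans (cong (_∷ʳ c) (stairs-empty 0 X (suc-injective ∣X∣≡)))
      (sym (stairs-∷ʳ-outside 0 (⊤ {n = c}))))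
isStaircase-∷ʳ (staircase (suc (suc _)) _ (s≤s ()) _ _ _) (short _) | _ | _ | _

-- Bounding the weight by the block widths.

endPos : ℕ → List ℕ → ℕ
endPos N []       = N
endPos N (c ∷ cs) = endPos (c + suc N) cs

-- `N` is the position of the zero before the block (a virtual one at the start), and every entry is
-- counted at its upper bound `suc N`, the first position of the block.
blockWeight : ℕ → ℕ → List ℕ → ℕ
blockWeight N w []       = w
blockWeight N w (c ∷ cs) = blockWeight (c + suc N) (w + c * suc N) cs

-- The bound and its equality case share one induction, `w` standing for the weight of the blocks
-- `bs` already read: equality after `c` forces equality before it and no loss from `c`.
blockWeight-optimal : ∀ cs {bs N w} → w ≤ maxWeight N →
  (maxWeight N ≤ w → IsStaircase (coords N) bs) →
  blockWeight N w cs ≤ maxWeight (endPos N cs) ×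
  (maxWeight (endPos N cs) ≤ blockWeight N w cs → IsStaircase (coords (endPos N cs)) (bs ++ cs))
blockWeight-optimal [] {bs} w≤ tight rewrite ++-identityʳ bs = w≤ , tight
blockWeight-optimal (c ∷ cs) {bs} {N} {w} w≤ tight =
  subst (λ b → blockWeight N w (c ∷ cs) ≤ maxWeight (endPos N (c ∷ cs)) ×
      (maxWeight (endPos N (c ∷ cs)) ≤ blockWeight N w (c ∷ cs) →
        IsStaircase (coords (endPos N (c ∷ cs))) b))
    (∷ʳ-++ bs c cs)
    (blockWeight-optimal cs (≤-trans (+-monoˡ-≤ (c * suc N) w≤) (withBlock-≤ N c)) λ h →
      isStaircase-∷ʳ {N}
        (tight (+-cancelʳ-≤ (c * suc N) _ _ (≤-trans (withBlock-≤ N c) h)))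
        (blockWidth N c (≤-trans h (+-monoˡ-≤ (c * suc N) w≤))))

-- Empty blocks are kept, so that the widths determine the position of every zero.
widths : ∀ {n} → ℕ → Vec ℕ n → List ℕ
widths c []           = c ∷ []
widths c (zero  ∷ xs) = c ∷ widths 0 xs
widths c (suc _ ∷ xs) = widths (suc c) xs

endPos-widths : ∀ {n} N c (xs : Vec ℕ n) → endPos N (widths c xs) ≡ n + (c + suc N)
endPos-widths N c [] = refl
endPos-widths {suc n} N c (zero  ∷ xs) =
  trans (endPos-widths (c + suc N) 0 xs) (+-suc n (c + suc N))
endPos-widths {suc n} N c (suc _ ∷ xs) =
  trans (endPos-widths N (suc c) xs) (+-suc n (c + suc N))

-- The entries continue a jump-float sequence whose last entry is v, the next
-- position being k.
JumpFloatFrom : ∀ {n} → ℕ → ℕ → Vec ℕ n → Set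
JumpFloatFrom k v []       = Unit
JumpFloatFrom k v (x ∷ xs) = x ≤ k × (x > v → v ≡ 0) × JumpFloatFrom (suc k) x xs

-- A further nonzero entry is at most `suc N`: in an empty block by its position, otherwise because
-- the preceding entry `v` is nonzero, which forbids an increase.
sum≤blockWeight : ∀ {n} N w c v (xs : Vec ℕ n) → JumpFloatFrom (c + suc N) v xs →
  v ≤ suc N → c ≡ 0 ⊎ 0 < v → w + c * suc N + Vec.sum xs ≤ blockWeight N w (widths c xs)
sum≤blockWeight N w c v [] _ _ _ = ≤-reflexive (+-identityʳ _)
sum≤blockWeight N w c v (zero ∷ xs) (_ , _ , jf) _ _ =
  subst (_≤ blockWeight N w (widths c (zero ∷ xs))) (cong (_+ Vec.sum xs) (+-identityʳ _))
    (sum≤blockWeight (c + suc N) (w + c * suc N) 0 0 xs jf z≤n (inj₁ refl))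
sum≤blockWeight N w c v (suc x ∷ xs) (x≤ , jump , jf) v≤ inBlock =
  ≤-trans (≤-trans (+-monoʳ-≤ (w + c * suc N) (+-monoˡ-≤ (Vec.sum xs) (x≤start inBlock)))
      (≤-reflexive (arith w c (suc N) (Vec.sum xs))))
    (sum≤blockWeight N w (suc c) (suc x) xs jf (x≤start inBlock) (inj₂ (s≤s z≤n)))
  where
  arith : ∀ w c p s → w + c * p + (p + s) ≡ w + suc c * p + s
  arith = solve-∀
  x≤start : c ≡ 0 ⊎ 0 < v → suc x ≤ suc N
  x≤start (inj₁ refl) = x≤
  x≤start (inj₂ 0<v) with ≤-<-connex (suc x) v
  ... | inj₁ x≤v = ≤-trans x≤v v≤
  ... | inj₂ v<x = contradiction (sym (jump v<x)) (<⇒≢ 0<v)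

jumpFloatFrom : ∀ {n} k v (s : Vec ℕ n) →
  (∀ i → Vec.lookup s i ≤ toℕ i + k) →
  (∀ i j → toℕ j ≡ suc (toℕ i) → Vec.lookup s j > Vec.lookup s i → Vec.lookup s i ≡ 0) →
  (∀ i → toℕ i ≡ 0 → Vec.lookup s i > v → v ≡ 0) → JumpFloatFrom k v s
jumpFloatFrom k v []      _       _    _     = tt
jumpFloatFrom k v (x ∷ s) bounded jump first = bounded zero , first zero refl ,
  jumpFloatFrom (suc k) x s
    (λ i → ≤-trans (bounded (suc i)) (≤-reflexive (sym (+-suc (toℕ i) k))))
    (λ i j eq → jump (suc i) (suc j) (cong suc eq))
    (λ i eq → jump zero (suc i) (cong suc eq))

jumpFloatFrom-bounded : ∀ {n} k v (s : Vec ℕ n) → JumpFloatFrom k v s →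
  ∀ i → Vec.lookup s i ≤ toℕ i + k
jumpFloatFrom-bounded k v (x ∷ s) (x≤ , _) zero = x≤
jumpFloatFrom-bounded k v (x ∷ s) (_ , _ , jf) (suc i) =
  ≤-trans (jumpFloatFrom-bounded (suc k) x s jf i) (≤-reflexive (+-suc (toℕ i) k))

jumpFloatFrom-jump : ∀ {n} k v (s : Vec ℕ n) → JumpFloatFrom k v s → ∀ i j →
  toℕ j ≡ suc (toℕ i) → Vec.lookup s j > Vec.lookup s i → Vec.lookup s i ≡ 0
jumpFloatFrom-jump k v (x ∷ y ∷ s) (_ , _ , _ , jump , _) zero (suc zero) _ = jump
jumpFloatFrom-jump k v (x ∷ s) (_ , _ , jf) (suc i) (suc j) eq =
  jumpFloatFrom-jump (suc k) x s jf i j (suc-injective eq)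

toJumpFloatFrom : ∀ {n} {s : Vec ℕ n} → IsJumpFloat s → JumpFloatFrom 1 0 s
toJumpFloatFrom {s = s} jf = jumpFloatFrom 1 0 s
  (λ i → ≤-trans (IsJumpFloat.bounded jf i) (≤-reflexive (+-comm 1 (toℕ i))))
  (IsJumpFloat.jump jf) (λ _ _ _ → refl)

fromJumpFloatFrom : ∀ {n} {s : Vec ℕ n} → JumpFloatFrom 1 0 s → IsJumpFloat s
fromJumpFloatFrom {s = s} jf = record
  { bounded = λ i → ≤-trans (jumpFloatFrom-bounded 1 0 s jf i) (≤-reflexive (+-comm (toℕ i) 1))
  ; jump    = jumpFloatFrom-jump 1 0 s jf
  }

-- Sequences that attain the bound.

jumpFloatFrom-++ : ∀ {m n} k v (s : Vec ℕ m) (t : Vec ℕ n) → JumpFloatFrom k v s →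
  JumpFloatFrom (suc (m + k)) 0 t → JumpFloatFrom k v (s Vec.++ 0 ∷ t)
jumpFloatFrom-++ k v []      t _  jt = z≤n , (λ ()) , jt
jumpFloatFrom-++ {suc m} k v (x ∷ s) t (x≤ , jump , js) jt = x≤ , jump ,
  jumpFloatFrom-++ (suc k) x s t js (subst (λ z → JumpFloatFrom (suc z) 0 t) (sym (+-suc m k)) jt)

jumpFloatFrom-replicate : ∀ c {k p v} → p ≤ k → (p > v → v ≡ 0) →
  JumpFloatFrom k v (Vec.replicate c p)
jumpFloatFrom-replicate zero    _   _    = tt
jumpFloatFrom-replicate (suc c) p≤k jump = p≤k , jump ,
  jumpFloatFrom-replicate c (m≤n⇒m≤1+n p≤k) (λ p>p → contradiction p>p (<-irrefl refl))

sum-replicate : ∀ c p → Vec.sum (Vec.replicate c p) ≡ c * p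
sum-replicate zero    p = refl
sum-replicate (suc c) p = cong (p +_) (sum-replicate c p)

T-suc : ∀ i → T (suc i) ≡ T i + suc i
T-suc i = begin
    (suc i + 1) C 2          ≡⟨ sym (nCk+nC[k+1]≡[n+1]C[k+1] (i + 1) 1) ⟩
    (i + 1) C 1 + (i + 1) C 2 ≡⟨ cong (_+ T i) (trans (nC1≡n (i + 1)) (+-comm i 1)) ⟩
    suc i + T i              ≡⟨ +-comm (suc i) (T i) ⟩
    T i + suc i              ∎
  where open ≡-Reasoning

-- `n≡` restates the defining equation of ρ and λ without subtraction, with `l + m` for ρ + 1 and
-- `l` for λ; it later shows that `t` has the required length.
record Attained (l m : ℕ) : Set where
  constructor attained
  field
    {n}     : ℕ
    t       : Vec ℕ n
    coords≡ : coords (suc n) ≡ (l , m)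
    n≡      : suc (suc n) ≡ T (l + m) + l
    jf      : JumpFloatFrom 1 0 t
    maximal : maxWeight (suc n) ≤ Vec.sum t

appendBlock : ∀ {n} c → Vec ℕ n → Vec ℕ (n + suc c)
-- The zero takes position `suc n`, so the block starts at `suc (suc n)`.
appendBlock {n} c t = t Vec.++ 0 ∷ Vec.replicate c (suc (suc n))

appendBlock-attained : ∀ {l m n} c (t : Vec ℕ n) → JumpFloatFrom 1 0 t →
  maxWeight (suc n) ≤ Vec.sum t →
  coords (c + suc (suc n)) ≡ (l , m) →
  suc (c + suc (suc n)) ≡ T (l + m) + l →
  maxWeight (c + suc (suc n)) ≤ withBlock (suc n) c → Attained l m
appendBlock-attained {n = n} c t jf max coords≡ n≡ block = attained (appendBlock c t)
  (trans (cong coords length≡) coords≡) (trans (cong suc length≡) n≡)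
  (jumpFloatFrom-++ 1 0 t _ jf (jumpFloatFrom-replicate c (≤-reflexive (cong suc (+-comm 1 n))) (λ _ → refl)))
  (begin
    maxWeight (suc (n + suc c))               ≡⟨ cong maxWeight length≡ ⟩
    maxWeight (c + suc (suc n))               ≤⟨ block ⟩
    maxWeight (suc n) + c * suc (suc n)       ≤⟨ +-monoˡ-≤ _ max ⟩
    Vec.sum t + c * suc (suc n)               ≡⟨ cong (Vec.sum t +_) (sym (sum-replicate c (suc (suc n)))) ⟩
    Vec.sum t + Vec.sum (Vec.replicate c (suc (suc n))) ≡⟨ sym (sum-++ t) ⟩
    Vec.sum (appendBlock c t)                 ∎)
  where
  open ≤-Reasoning
  length≡ : suc (n + suc c) ≡ c + suc (suc n)
  length≡ = trans (cong suc (+-comm n (suc c))) (sym (trans (+-suc c (suc n)) (cong suc (+-suc c n))))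

attained-narrow : ∀ {l m} → Attained l m → Attained l (suc m)
attained-narrow {l} {m} (attained {n} t coords≡ n≡ jf max) =
  appendBlock-attained (κ N) t jf max
    (trans (coords-shift N) (cong (λ p → proj₁ p , suc (proj₂ p)) coords≡))
    (begin
      suc (κ N + suc N)           ≡⟨ cong₂ (λ x y → suc (x + y)) (κ-of N coords≡) n≡ ⟩
      suc (l + m + (T (l + m) + l)) ≡⟨ arith (l + m) (T (l + m)) l ⟩
      T (l + m) + suc (l + m) + l ≡⟨ cong (_+ l) (sym (T-suc (l + m))) ⟩
      T (suc (l + m)) + l         ≡⟨ cong (λ z → T z + l) (sym (+-suc l m)) ⟩
      T (l + suc m) + l           ∎)
    (≤-reflexive (maxWeight-shift N))
  where
  open ≡-Reasoning
  N : ℕ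
  N = suc n
  arith : ∀ k t l → suc (k + (t + l)) ≡ t + suc k + l
  arith = solve-∀

attained-wide : ∀ {l m} → Attained l m → Attained (suc l) m
attained-wide {l} {m} (attained {n} t coords≡ n≡ jf max) =
  appendBlock-attained (suc (κ N)) t jf max
    (cong next (trans (coords-shift N) (cong (λ p → proj₁ p , suc (proj₂ p)) coords≡)))
    (begin
      suc (suc (κ N) + suc N)           ≡⟨ cong₂ (λ x y → suc (suc (x + y))) (κ-of N coords≡) n≡ ⟩
      suc (suc (l + m + (T (l + m) + l))) ≡⟨ arith (l + m) (T (l + m)) l ⟩
      T (l + m) + suc (l + m) + suc l ≡⟨ cong (_+ suc l) (sym (T-suc (l + m))) ⟩
      T (suc (l + m)) + suc l         ∎)
    (≤-reflexive (maxWeight-wide N))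
  where
  open ≡-Reasoning
  N : ℕ
  N = suc n
  arith : ∀ k t l → suc (suc (k + (t + l))) ≡ t + suc k + suc l
  arith = solve-∀

attain-zero : ∀ m → Attained 0 (suc (suc m))
-- The coordinates `(0 , 1)` belong to length -1, so the chain with λ = 0 starts at length 1.
attain-zero zero    = attained (1 ∷ []) refl refl (s≤s z≤n , (λ _ → refl) , tt) ≤-refl
attain-zero (suc m) = attained-narrow (attain-zero m)

-- The empty sequence has coordinates `(1 , 0)`; wide blocks raise the first one, then narrow blocks
-- the second.
attain-suc : ∀ l m → Attained (suc l) m
attain-suc zero    zero    = attained [] refl refl tt ≤-refl
attain-suc (suc l) zero    = attained-wide (attain-suc l zero)
attain-suc l       (suc m) = attained-narrow (attain-suc l m)

attain : ∀ {n ρ ℓ} → IsRhoLambda n ρ ℓ → ∃[ μ ] ρ + 1 ≡ ℓ + μ × Attained ℓ μ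
attain {ρ = suc r} {zero} _ = suc (r + 1) , refl , subst (λ z → Attained 0 (suc z)) (+-comm 1 r) (attain-zero r)
attain {ρ = ρ} {suc l} p = ρ + 1 ∸ suc l , sym (m+[n∸m]≡n (IsRhoLambda.ℓ≤ρ+1 p)) , attain-suc l _
attain {ρ = zero} {zero} (mkRhoLambda () _ _)

-- From maximum weight to a staircase.

isRhoLambda⇒T : ∀ {n ρ ℓ} → IsRhoLambda n ρ ℓ → suc (suc n) ≡ T (ρ + 1) + ℓ
isRhoLambda⇒T {n} {suc r} {ℓ} (mkRhoLambda _ _ n≡) = begin
    2 + n                       ≡⟨ cong (2 +_) n≡ ⟩
    2 + (T (suc r + 1) ∸ 2) + ℓ ≡⟨ cong (_+ ℓ) (m+[n∸m]≡n 2≤T) ⟩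
    T (suc r + 1) + ℓ           ∎
  where
  open ≡-Reasoning
  2≤T : 2 ≤ T (suc r + 1)
  2≤T = subst (2 ≤_) (sym (T-suc (r + 1)))
    (m≤n⇒m≤o+n (T (r + 1)) (s≤s (≤-trans (s≤s z≤n) (≤-reflexive (+-comm 1 r)))))

maxWeight-coords : ∀ {n ρ ℓ} → IsRhoLambda n ρ ℓ → ∃[ μ ] ρ + 1 ≡ ℓ + μ ×
  coords (suc n) ≡ (ℓ , μ) × ∃[ t ] IsJumpFloat {n} t × maxWeight (suc n) ≤ weight t
maxWeight-coords {ρ = ρ} {ℓ} p with attain p
... | μ , ρ+1≡ , attained t coords≡ n≡ jf max
  with refl ← suc-injective (suc-injective
    (trans n≡ (trans (cong (λ z → T z + ℓ) (sym ρ+1≡)) (sym (isRhoLambda⇒T p)))))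
  = μ , ρ+1≡ , coords≡ , t , fromJumpFloatFrom jf , max

-- The attaining sequence `t` puts `blockWeight` at or above `maxWeight`, which is the equality case
-- of `blockWeight-optimal`.
maximum⇒isStaircase : ∀ {n ρ ℓ} → IsRhoLambda n ρ ℓ → (s : Vec ℕ n) → IsMaxWeight s →
  ∃[ μ ] ρ + 1 ≡ ℓ + μ × IsStaircase (ℓ , μ) (widths 0 s)
maximum⇒isStaircase {n} p s s-max with maxWeight-coords p
... | μ , ρ+1≡ , coords≡ , t , t-jf , max =
  μ , ρ+1≡ , subst (λ z → IsStaircase z (widths 0 s)) (trans (cong coords end≡) coords≡)
    -- The start has no blocks, λ = 0, ρ = 0 and offset 1.
    (proj₂ (blockWeight-optimal (widths 0 s) {[]} {0} {0} z≤n (λ _ → staircase 1 [] ≤-refl refl refl refl))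
      (begin
        maxWeight (endPos 0 (widths 0 s)) ≡⟨ cong maxWeight end≡ ⟩
        maxWeight (suc n)                 ≤⟨ max ⟩
        weight t                          ≤⟨ IsMaxWeight.maximum s-max t t-jf ⟩
        weight s                          ≤⟨ sum≤blockWeight 0 0 0 0 s
                                              (toJumpFloatFrom (IsMaxWeight.jumpFloat s-max)) z≤n (inj₁ refl) ⟩
        blockWeight 0 0 (widths 0 s)      ∎))
  where
  open ≤-Reasoning
  end≡ : endPos 0 (widths 0 s) ≡ suc n
  end≡ = trans (endPos-widths 0 0 s) (+-comm n 1)

-- Widths and the extended block sequence.

-- The worker of wordsBy is local to it.  Abstracting both of its arguments in
-- wordsBy-widths lets unification solve for it.
wordsByWorker : List ℕ → List ℕ → List (List ℕ)

wordsBy-widths : ∀ {n} (xs : Vec ℕ n) → All NonZero (widths 0 xs) → blockSequence xs ≡ widths 0 xs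

wordsByWorker-widths : ∀ acc ys {n} (xs : Vec ℕ n) {c} → length acc ≡ c → toList xs ≡ ys →
  All NonZero (widths c xs) → map length (wordsByWorker acc ys) ≡ widths c xs

wordsByWorker = _

wordsBy-widths xs nz with List.[] {A = ℕ} in acc≡ | toList xs in ys≡
... | acc | ys = wordsByWorker-widths acc ys xs (sym (cong length acc≡)) ys≡ nz

wordsByWorker-widths []        _ []           refl refl (() ∷ _)
wordsByWorker-widths (a ∷ acc) _ []           refl refl _        = cong (_∷ []) (length-reverse (a ∷ acc))
wordsByWorker-widths []        _ (zero  ∷ xs) refl refl (() ∷ _)
wordsByWorker-widths (a ∷ acc) _ (zero  ∷ xs) refl refl (_ ∷ nz) =
  cong₂ _∷_ (length-reverse (a ∷ acc)) (wordsByWorker-widths [] _ xs refl refl nz)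
wordsByWorker-widths acc       _ (suc x ∷ xs) refl refl nz       =
  wordsByWorker-widths (suc x ∷ acc) _ xs refl refl nz

nonZero-widths-suc : ∀ {n} c (xs : Vec ℕ n) → All NonZero (drop 1 (widths (suc c) xs)) →
  All NonZero (widths (suc c) xs)
nonZero-widths-suc c []           nz = _ ∷ nz
nonZero-widths-suc c (zero  ∷ xs) nz = _ ∷ nz
nonZero-widths-suc c (suc _ ∷ xs) nz = nonZero-widths-suc (suc c) xs nz

-- The two lists can differ only in empty blocks. The one before an initial zero is the 0 that the
-- extension prepends; the hypothesis excludes those from adjacent zeros or a final zero.
extendedBlockSequence≡widths : ∀ {n} (s : Vec ℕ (suc n)) → All NonZero (drop 1 (widths 0 s)) →
  extendedBlockSequence s ≡ widths 0 s
extendedBlockSequence≡widths (zero  ∷ xs)   nz = cong (0 ∷_) (wordsBy-widths xs nz)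
extendedBlockSequence≡widths s@(suc _ ∷ xs) nz = wordsBy-widths s (nonZero-widths-suc 0 xs nz)

nonZero-stairs : ∀ {m} o (X : Subset m) → All NonZero (stairs (suc o) X)
nonZero-stairs o []            = []
nonZero-stairs o (inside  ∷ X) = _ ∷ nonZero-stairs (suc o) X
nonZero-stairs o (outside ∷ X) = _ ∷ nonZero-stairs (suc o) X

-- At offset 0 only the first stair can be 0, matching an initial zero of the sequence.
nonZero-drop-stairs : ∀ {m} o (X : Subset m) → All NonZero (drop 1 (stairs o X))
nonZero-drop-stairs o []            = []
nonZero-drop-stairs o (inside  ∷ X) = nonZero-stairs o X
nonZero-drop-stairs o (outside ∷ X) = nonZero-stairs o X

stairs≡tabulate : ∀ {m} o (X : Subset m) →
  stairs o X ≡ tabulate (λ i → if does (i ∈? X) then suc (o + toℕ i) else o + toℕ i)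
stairs≡tabulate o []            = refl
stairs≡tabulate o (inside ∷ X) = cong₂ _∷_ (cong suc (sym (+-identityʳ o)))
  (trans (stairs≡tabulate (suc o) X) (tabulate-cong λ i →
    cong₂ (if does (i ∈? X) then_else_) (cong suc (sym (+-suc o (toℕ i)))) (sym (+-suc o (toℕ i)))))
stairs≡tabulate o (outside ∷ X) = cong₂ _∷_ (sym (+-identityʳ o))
  (trans (stairs≡tabulate (suc o) X) (tabulate-cong λ i →
    cong₂ (if does (i ∈? X) then_else_) (cong suc (sym (+-suc o (toℕ i)))) (sym (+-suc o (toℕ i)))))

isStaircase⇒form : ∀ {ρ ℓ μ b} → ρ + 1 ≡ ℓ + μ → IsStaircase (ℓ , μ) b → FormA ρ ℓ b ⊎ FormB ρ ℓ b
isStaircase⇒form {ρ} ρ+1≡ (staircase zero X _ m≡ ∣X∣≡ refl)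
  with refl ← trans m≡ (sym ρ+1≡) =
  inj₂ (X , trans (+-comm ∣ X ∣ 1) ∣X∣≡ , stairs≡tabulate 0 X)
isStaircase⇒form {ρ} ρ+1≡ (staircase (suc zero) X _ m≡ ∣X∣≡ refl)
  with refl ← suc-injective (trans m≡ (trans (sym ρ+1≡) (+-comm ρ 1))) =
  inj₁ (X , suc-injective ∣X∣≡ , trans (stairs≡tabulate 1 X) (tabulate-cong λ i →
    cong (if does (i ∈? X) then_else suc (toℕ i)) (+-comm 1 (suc (toℕ i)))))
isStaircase⇒form _ (staircase (suc (suc _)) _ (s≤s ()) _ _ _)

theorem4p3 : ∀ (n : ℕ) → n ≥ 1 → ∀ (ρ ℓ : ℕ) → IsRhoLambda n ρ ℓ →
    ∀ (s : Vec ℕ n) → IsMaxWeight s →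
    FormA ρ ℓ (extendedBlockSequence s) ⊎ FormB ρ ℓ (extendedBlockSequence s)
theorem4p3 (suc n) _ ρ ℓ p s s-max with maximum⇒isStaircase p s s-max
... | μ , ρ+1≡ , st@(staircase o X _ _ _ widths≡) =
  isStaircase⇒form ρ+1≡ (subst (IsStaircase (ℓ , μ)) (sym extended≡) st)
  where
  extended≡ : extendedBlockSequence s ≡ widths 0 s
  extended≡ = extendedBlockSequence≡widths s
    (subst (λ b → All NonZero (drop 1 b)) (sym widths≡) (nonZero-drop-stairs o X))
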